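{- Let $\Sigma$ be a signature and consider derivations in $\mathcal{J}(\Sigma)$. Suppose $\vdash_{\bar m}\bar s:\Theta\to\Gamma$. (a) If $\vdash_k B$ type $(\Gamma)$, then $\vdash_{k+\max(\bar m)} B[\bar s/\Gamma]$ type $(\Theta)$. (b) If $\vdash_k b:B\ (\Gamma)$, then $\vdash_{k+\max(\bar m)} b[\bar s/\Gamma]:B[\bar s/\Gamma]\ (\Theta)$.
   Context: Fix an infinite set $V$ of variables with decidable equality, and a fresh variable provider: functions $\varphi,\mathsf{fr}$ assigning to each finite $X\subseteq V$ an inhabited subset $\varphi(X)\subseteq V\setminus X$ and an element $\mathsf{fr}(X)\in\varphi(X)$. Fix disjoint sets $F$ (function symbols) and $T$ (type symbols) with decidable equality. Preelements are terms built from variables and symbols of $F$; a pretype is $S(t_1,\ldots,t_n)$ with $S\in T$ and $t_i$ preelements. $\mathrm{V}(E)$ is the set of variables of an expression $E$, $\equiv$ is syntactic identity, and $E[\bar a/\bar x]$ is simultaneous substitution. A precontext is a sequence $\Gamma=x_1:A_1,\ldots,x_n:A_n$ of pretypes with $x_k\in\varphi(\{x_1,\ldots,x_{k-1}\})$ and $\mathrm{V}(A_k)\subseteq\{x_1,\ldots,x_{k-1}\}$; $\mathrm{OV}(\Gamma)=x_1,\ldots,x_n$, $\mathrm{V}(\Gamma)=\{x_1,\ldots,x_n\}$, $\mathrm{Fresh}(\Gamma)=\varphi(\mathrm{V}(\Gamma))$, $\mathrm{fresh}(\Gamma)=\mathsf{fr}(\mathrm{V}(\Gamma))$, $E[\bar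 a/\Gamma]=E[\bar a/x_1,\ldots,x_n]$. Top variables: $\mathrm{TV}(\langle\rangle)=\emptyset$, $\mathrm{TV}(\Gamma,x:A)=(\mathrm{TV}(\Gamma)\setminus\mathrm{V}(A))\cup\{x\}$. A determining sequence for $\Gamma$ is a strictly increasing $\bar i=i_1,\ldots,i_k$ in $\{1,\ldots,n\}$ with $\mathrm{TV}(\Gamma)\subseteq\{x_{i_1},\ldots,x_{i_k}\}$; for $\bar a=a_1,\ldots,a_n$ put $\bar a_{\bar i}=a_{i_1},\ldots,a_{i_k}$. A type predeclaration is $(\Gamma,S,\bar i)$ with $S\in T$, $\bar i$ determining; a function predeclaration is $(\Gamma,f,\bar i,U)$ with $f\in F$, $\bar i$ determining, $U$ a pretype with $\mathrm{V}(U)\subseteq\mathrm{V}(\Gamma)$. A presignature is a set $\Sigma$ of predeclarations with no symbol declared twice. Judgements are "$\Gamma$ context", "$A$ type $(\Gamma)$", "$a:A\ (\Gamma)$". $\mathcal{J}(\Sigma)$ is the smallest set of judgements closed under: (R1) $\langle\rangle$ context; (R2) from $\Gamma$ context and $A$ type $(\Gamma)$ infer $\Gamma,x:A$ context, for $x\in\mathrm{Fresh}(\Gamma)$; (R3) from $x_1:A_1,\ldots,x_n:A_n$ context infer $x_i:A_i\ (x_1:A_1,\ldots,x_n:A_n)$; (R4) if $(\Gamma,S,\bar i)\in\Sigma$ and $\bar a:\Delta\to\Gamma$, infer $S(\bar a_{\bar i})$ type $(\Delta)$; (R5) if $(\Gamma,f,\bar i,U)\in\Sigma$, $\bar a:\Delta\to\Gamma$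 and $U[\bar a/\Gamma]$ type $(\Delta)$, infer $f(\bar a_{\bar i}):U[\bar a/\Gamma]\ (\Delta)$. Here, for $\Gamma=x_1:A_1,\ldots,x_n:A_n$, the context map "$\bar a:\Delta\to\Gamma$" abbreviates the $n+2$ judgements $\Delta$ context, $\Gamma$ context, and $a_k:A_k[a_1,\ldots,a_{k-1}/x_1,\ldots,x_{k-1}]\ (\Delta)$ for $k=1,\ldots,n$. $\Sigma$ is a signature if ($\Gamma$ context)$\in\mathcal{J}(\Sigma)$ whenever $(\Gamma,S,\bar i)\in\Sigma$, and ($U$ type $(\Gamma)$)$\in\mathcal{J}(\Sigma)$ whenever $(\Gamma,f,\bar i,U)\in\Sigma$. Heights: a derivation consisting of a single application of (R1) has height $0$; applying a rule to premisses derived with heights $h_1,\ldots,h_r$ gives height $1+\max_j h_j$. $\vdash_k\mathcal U$ means $\mathcal U$ has a derivation in $\mathcal{J}(\Sigma)$ of height at most $k$. For a context map $\bar a:\Delta\to\Gamma$ with $|\Gamma|=n$, $\vdash_{m_1,\ldots,m_{n+2}}\bar a:\Delta\to\Gamma$ means its $n+2$ constituent judgements (in the order listed above) have derivations of heights at most $m_1,\ldots,m_{n+2}$; $\max(\bar m)$ is the largest $m_j$. -}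

module Defs where

open import Data.Fin as Fin using (Fin)
open import Data.List as List using (List; []; _∷_; _++_)
open import Data.List.Extrema.Nat using (max)
open import Data.List.Membership.Propositional using (_∈_; _∉_)
open import Data.List.Relation.Binary.Pointwise using (Pointwise)
open import Data.List.Relation.Binary.Subset.Propositional using (_⊆_)
open import Data.List.Relation.Unary.All using (All; []; _∷_)
open import Data.List.Relation.Unary.Linked using (Linked)
import Data.List.Membership.DecPropositional as DecMembership
open import Data.Nat using (ℕ; zero; suc; _≤_)
open import Data.Product using (∃; _×_)
open import Data.Sum using (_⊎_; inj₁; inj₂)
open import Data.Vec as Vec using (Vec; []; _∷_; _∷ʳ_)
open import Level using (0ℓ)
open import Relation.Binary.Definitions using (DecidableEquality)
open import Relation.Binary.PropositionalEquality using (_≡_)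
open import Relation.Nullary using (yes; no; ¬?)
open import Relation.Unary using (Pred)

-- A finite subset of Var is given by a list enumerating it.  The laws φ-resp
-- and fr-resp say that φ and fr depend only on the subset, not on the list.
-- F and T are separate types, which makes the two kinds of symbol disjoint.
record Language : Set₁ where
  field
    Var      : Set
    _≟ᵛ_     : DecidableEquality Var
    infinite : (X : List Var) → ∃ λ x → x ∉ X

    φ        : List Var → Pred Var 0ℓ
    φ-avoids : ∀ {X x} → φ X x → x ∉ X
    φ-resp   : ∀ {X Y} → X ⊆ Y → Y ⊆ X → ∀ {x} → φ X x → φ Y x
    fr       : List Var → Var
    fr∈φ     : ∀ X → φ X (fr X)
    fr-resp  : ∀ {X Y} → X ⊆ Y → Y ⊆ X → fr X ≡ fr Y

    F        : Set
    _≟ᶠ_     : DecidableEquality F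
    T        : Set
    _≟ᵗ_     : DecidableEquality T

module Syntax (L : Language) where
  open Language L
  open DecMembership _≟ᵛ_ using (_∈?_)

  infix  30 _[_/_]ᵉ _[_/_]ᵉˢ _[_/_]ᵗ
  infixl 20 _▸_∶_
  infix  10 _context _type⟨_⟩ _∶_⟨_⟩

  -- Symbols carry no arity: they may be applied to any finite sequence.
  data Preelement : Set where
    var : Var → Preelement
    fun : F → List Preelement → Preelement

  data Pretype : Set where
    typ : T → List Preelement → Pretype

  varsᵉ  : Preelement → List Var
  varsᵉˢ : List Preelement → List Var
  varsᵉ (var x)    = x ∷ []
  varsᵉ (fun f ts) = varsᵉˢ ts
  varsᵉˢ []        = []
  varsᵉˢ (t ∷ ts)  = varsᵉ t ++ varsᵉˢ ts

  varsᵗ : Pretype → List Var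
  varsᵗ (typ S ts) = varsᵉˢ ts

  -- What the simultaneous substitution [ ā / x̄ ] does to a single variable.
  -- It is only meant for x̄ without repetitions; otherwise the first match wins.
  assign : ∀ {n} → Vec Preelement n → Vec Var n → Var → Preelement
  assign []      []      y = var y
  assign (a ∷ ā) (x ∷ x̄) y with y ≟ᵛ x
  ... | yes _ = a
  ... | no  _ = assign ā x̄ y

  _[_/_]ᵉ  : ∀ {n} → Preelement → Vec Preelement n → Vec Var n → Preelement
  _[_/_]ᵉˢ : ∀ {n} → List Preelement → Vec Preelement n → Vec Var n → List Preelement
  var y    [ ā / x̄ ]ᵉ  = assign ā x̄ y
  fun f ts [ ā / x̄ ]ᵉ  = fun f (ts [ ā / x̄ ]ᵉˢ)
  []       [ ā / x̄ ]ᵉˢ = []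
  (t ∷ ts) [ ā / x̄ ]ᵉˢ = t [ ā / x̄ ]ᵉ ∷ ts [ ā / x̄ ]ᵉˢ

  _[_/_]ᵗ : ∀ {n} → Pretype → Vec Preelement n → Vec Var n → Pretype
  typ S ts [ ā / x̄ ]ᵗ = typ S (ts [ ā / x̄ ]ᵉˢ)

  -- Raw sequences x₁ : A₁, …, xₙ : Aₙ; IsPrecontext singles out the precontexts.
  data Ctx : Set where
    ⟨⟩    : Ctx
    _▸_∶_ : Ctx → Var → Pretype → Ctx

  ∣_∣ : Ctx → ℕ
  ∣ ⟨⟩ ∣        = zero
  ∣ Γ ▸ x ∶ A ∣ = suc ∣ Γ ∣

  OV : (Γ : Ctx) → Vec Var ∣ Γ ∣
  OV ⟨⟩          = []
  OV (Γ ▸ x ∶ A) = OV Γ ∷ʳ x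

  types : (Γ : Ctx) → Vec Pretype ∣ Γ ∣
  types ⟨⟩          = []
  types (Γ ▸ x ∶ A) = types Γ ∷ʳ A

  varsᶜ : Ctx → List Var
  varsᶜ Γ = Vec.toList (OV Γ)

  Fresh : Ctx → Pred Var 0ℓ
  Fresh Γ = φ (varsᶜ Γ)

  data IsPrecontext : Ctx → Set where
    ⟨⟩  : IsPrecontext ⟨⟩
    ext : ∀ {Γ x A} → IsPrecontext Γ → Fresh Γ x → varsᵗ A ⊆ varsᶜ Γ →
          IsPrecontext (Γ ▸ x ∶ A)

  TV : Ctx → List Var
  TV ⟨⟩          = []
  TV (Γ ▸ x ∶ A) = List.filter (λ y → ¬? (y ∈? varsᵗ A)) (TV Γ) List.∷ʳ x

  -- The sequence ā_ī; positions are counted from 0.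
  select : ∀ {A : Set} {n} → Vec A n → List (Fin n) → List A
  select ā ī = List.map (Vec.lookup ā) ī

  IsDetermining : (Γ : Ctx) → List (Fin ∣ Γ ∣) → Set
  IsDetermining Γ ī = Linked Fin._<_ ī × TV Γ ⊆ select (OV Γ) ī

  data Declaration : Set where
    typeDecl : (Γ : Ctx) → T → List (Fin ∣ Γ ∣) → Declaration
    funDecl  : (Γ : Ctx) → F → List (Fin ∣ Γ ∣) → Pretype → Declaration

  data IsPredeclaration : Declaration → Set where
    typeDecl : ∀ {Γ S ī} → IsPrecontext Γ → IsDetermining Γ ī →
               IsPredeclaration (typeDecl Γ S ī)
    funDecl  : ∀ {Γ f ī U} → IsPrecontext Γ → IsDetermining Γ ī → varsᵗ U ⊆ varsᶜ Γ →
               IsPredeclaration (funDecl Γ f ī U)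

  symbol : Declaration → T ⊎ F
  symbol (typeDecl Γ S ī)  = inj₁ S
  symbol (funDecl Γ f ī U) = inj₂ f

  record Presignature : Set₁ where
    field
      Declares       : Pred Declaration 0ℓ
      predeclaration : ∀ {d} → Declares d → IsPredeclaration d
      declaredOnce   : ∀ {d d′} → Declares d → Declares d′ → symbol d ≡ symbol d′ → d ≡ d′

  open Presignature using (Declares)

  data Judgement : Set where
    _context : Ctx → Judgement
    _type⟨_⟩ : Pretype → Ctx → Judgement
    _∶_⟨_⟩   : Preelement → Pretype → Ctx → Judgement

  -- The judgements aₖ : Aₖ[a₁,…,aₖ₋₁/x₁,…,xₖ₋₁] (Δ) for k = 1, …, n, in this order.
  components : (Δ Γ : Ctx) → Vec Preelement ∣ Γ ∣ → List Judgement
  components Δ ⟨⟩          ā = []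
  components Δ (Γ ▸ x ∶ A) ā =
    components Δ Γ (Vec.init ā) List.∷ʳ (Vec.last ā ∶ A [ Vec.init ā / OV Γ ]ᵗ ⟨ Δ ⟩)

  -- The n + 2 judgements abbreviated by ā : Δ → Γ.
  contextMap : (Δ Γ : Ctx) → Vec Preelement ∣ Γ ∣ → List Judgement
  contextMap Δ Γ ā = (Δ context) ∷ (Γ context) ∷ components Δ Γ ā

  -- Rule Σ ps 𝒰: the judgement 𝒰 follows from the premisses ps by one rule.
  -- Only sequences satisfying IsPrecontext occur in derivable judgements: R2 is
  -- the only rule extending a context, and derivability of A type (Γ) implies
  -- that the variables of A are among those of Γ.
  data Rule (Σ : Presignature) : List Judgement → Judgement → Set where
    R1 : Rule Σ [] (⟨⟩ context)
    R2 : ∀ {Γ A x} → Fresh Γ x →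
         Rule Σ ((Γ context) ∷ (A type⟨ Γ ⟩) ∷ []) (Γ ▸ x ∶ A context)
    R3 : ∀ {Γ} (i : Fin ∣ Γ ∣) →
         Rule Σ ((Γ context) ∷ [])
                (var (Vec.lookup (OV Γ) i) ∶ Vec.lookup (types Γ) i ⟨ Γ ⟩)
    R4 : ∀ {Γ S ī Δ} → Declares Σ (typeDecl Γ S ī) → (ā : Vec Preelement ∣ Γ ∣) →
         Rule Σ (contextMap Δ Γ ā) (typ S (select ā ī) type⟨ Δ ⟩)
    R5 : ∀ {Γ f ī U Δ} → Declares Σ (funDecl Γ f ī U) → (ā : Vec Preelement ∣ Γ ∣) →
         Rule Σ (contextMap Δ Γ ā List.∷ʳ (U [ ā / OV Γ ]ᵗ type⟨ Δ ⟩))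
                (fun f (select ā ī) ∶ U [ ā / OV Γ ]ᵗ ⟨ Δ ⟩)

  -- 𝒥 Σ 𝒰 is the type of derivations of 𝒰.
  data 𝒥 (Σ : Presignature) : Judgement → Set where
    infer : ∀ {ps 𝒰} → Rule Σ ps 𝒰 → All (𝒥 Σ) ps → 𝒥 Σ 𝒰

  -- R1 is the only rule without premisses.
  inferenceHeight : List ℕ → ℕ
  inferenceHeight []       = 0
  inferenceHeight (h ∷ hs) = suc (max 0 (h ∷ hs))

  height  : ∀ {Σ 𝒰} → 𝒥 Σ 𝒰 → ℕ
  heights : ∀ {Σ ps} → All (𝒥 Σ) ps → List ℕ
  height (infer r ds) = inferenceHeight (heights ds)
  heights []          = []
  heights (d ∷ ds)    = height d ∷ heights ds

  record IsSignature (Σ : Presignature) : Set where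
    field
      typeDeclared : ∀ {Γ S ī} → Declares Σ (typeDecl Γ S ī) → 𝒥 Σ (Γ context)
      funDeclared  : ∀ {Γ f ī U} → Declares Σ (funDecl Γ f ī U) → 𝒥 Σ (U type⟨ Γ ⟩)

  infix 4 _⊢[_]_ _⊢⟨_⟩_⟶_∋_

  _⊢[_]_ : Presignature → ℕ → Judgement → Set
  Σ ⊢[ k ] 𝒰 = ∃ λ (d : 𝒥 Σ 𝒰) → height d ≤ k

  -- Σ ⊢⟨ m̄ ⟩ Δ ⟶ Γ ∋ ā means ⊢_m̄ ā : Δ → Γ; Γ comes before ā because
  -- the length of ā depends on it.  Pointwise forces m̄ to have length n + 2.
  _⊢⟨_⟩_⟶_∋_ : Presignature → List ℕ → Ctx → (Γ : Ctx) → Vec Preelement ∣ Γ ∣ → Set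
  Σ ⊢⟨ m̄ ⟩ Δ ⟶ Γ ∋ ā = Pointwise (Σ ⊢[_]_) m̄ (contextMap Δ Γ ā)

{-# OPTIONS --safe #-}

-- Induction on the height bound k.  A premiss context map ā : Γ → Γ₀ becomes
-- ā[s̄] : Θ → Γ₀, and the types in its components match because substitutions
-- compose, A[ā/Γ₀][s̄/Γ] ≡ A[ā[s̄]/Γ₀], when the variables of A are among those
-- of Γ₀.  The context Γ₀ itself is not touched and keeps its height, while
-- Γ context is replaced by Θ context, whose height is at most max m̄.  A variable
-- of Γ is sent to a component of s̄, whose height is again at most max m̄.
module Submission where

open import Defs
import Data.Fin as Fin
open import Data.Fin.Relation.Unary.Top using (View; view; ‵fromℕ; ‵inject₁)
open import Data.List as List using (List; []; _∷_)
open import Data.List.Extrema.Nat using (max; max≤v⁺; xs≤max)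
open import Data.List.Membership.Propositional using (_∈_; _∉_)
open import Data.List.Membership.Propositional.Properties using (∈-++⁺ˡ; ∈-++⁺ʳ; ∈-++⁻)
import Data.List.Properties as List
open import Data.List.Relation.Binary.Pointwise using (Pointwise; []; _∷_)
open import Data.List.Relation.Binary.Subset.Propositional using (_⊆_)
open import Data.List.Relation.Unary.All as All using (All; []; _∷_)
open import Data.List.Relation.Unary.All.Properties using (∷ʳ⁺; ∷ʳ⁻)
open import Data.List.Relation.Unary.Any using (here; there)
open import Data.Nat using (ℕ; suc; z≤n; s≤s; _+_; _≤_)
open import Data.Nat.Properties using (≤-trans; m≤m+n; m≤n+m)
open import Data.Product using (_×_; _,_; proj₁; proj₂)
open import Data.Sum using ([_,_]′)
open import Data.Vec as Vec using (Vec; []; _∷_; _∷ʳ_)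
open import Data.Vec.Membership.Propositional.Properties using (∈-lookup; ∈-toList⁺)
open import Data.Vec.Properties using (toList-∷ʳ; init-∷ʳ; last-∷ʳ; map-∷ʳ; lookup-map)
open import Function using (_∘_)
open import Relation.Binary.PropositionalEquality
  using (_≡_; refl; sym; trans; cong; cong₂; subst)
open import Relation.Nullary using (yes; no; contradiction)

-- Vectors extended at the right end, as `OV` and `types` are.

module _ {A : Set} where

  lookup-∷ʳ-fromℕ : ∀ {n} (xs : Vec A n) x → Vec.lookup (xs ∷ʳ x) (Fin.fromℕ n) ≡ x
  lookup-∷ʳ-fromℕ []       x = refl
  lookup-∷ʳ-fromℕ (_ ∷ xs) x = lookup-∷ʳ-fromℕ xs x

  lookup-∷ʳ-inject₁ : ∀ {n} (xs : Vec A n) x i →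
                      Vec.lookup (xs ∷ʳ x) (Fin.inject₁ i) ≡ Vec.lookup xs i
  lookup-∷ʳ-inject₁ (_ ∷ xs) x Fin.zero    = refl
  lookup-∷ʳ-inject₁ (_ ∷ xs) x (Fin.suc i) = lookup-∷ʳ-inject₁ xs x i

  init-last : ∀ {n} (xs : Vec A (suc n)) → xs ≡ Vec.init xs ∷ʳ Vec.last xs
  init-last xs = proj₂ (proj₂ (Vec.initLast xs))

  toList-⊆-∷ʳ : ∀ {n} (xs : Vec A n) {x} → Vec.toList xs ⊆ Vec.toList (xs ∷ʳ x)
  toList-⊆-∷ʳ xs {x} y∈xs rewrite toList-∷ʳ x xs = ∈-++⁺ˡ y∈xs

module _ {A B : Set} (f : A → B) where

  init-map : ∀ {n} (xs : Vec A (suc n)) → Vec.init (Vec.map f xs) ≡ Vec.map f (Vec.init xs)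
  init-map xs = trans (cong (Vec.init ∘ Vec.map f) (init-last xs))
    (trans (cong Vec.init (map-∷ʳ f (Vec.last xs) (Vec.init xs)))
           (init-∷ʳ (f (Vec.last xs)) (Vec.map f (Vec.init xs))))

  last-map : ∀ {n} (xs : Vec A (suc n)) → Vec.last (Vec.map f xs) ≡ f (Vec.last xs)
  last-map xs = trans (cong (Vec.last ∘ Vec.map f) (init-last xs))
    (trans (cong Vec.last (map-∷ʳ f (Vec.last xs) (Vec.init xs)))
           (last-∷ʳ (f (Vec.last xs)) (Vec.map f (Vec.init xs))))

module Metatheory (L : Language) where
  open Language L
  open Syntax L

  -- Substitution

  -- `assign` stops at the first match, so a variable of `x̄` is settled before the appended entry
  -- is reached.
  assign-∷ʳ-∈ : ∀ {n} (ā : Vec Preelement n) {a} (x̄ : Vec Var n) {x y} → y ∈ Vec.toList x̄ →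
                assign (ā ∷ʳ a) (x̄ ∷ʳ x) y ≡ assign ā x̄ y
  assign-∷ʳ-∈ (a ∷ ā) (x ∷ x̄) {y = y} y∈x̄ with y ≟ᵛ x
  ... | yes _ = refl
  assign-∷ʳ-∈ (a ∷ ā) (x ∷ x̄) (here y≡x)  | no y≢x = contradiction y≡x y≢x
  assign-∷ʳ-∈ (a ∷ ā) (x ∷ x̄) (there y∈x̄) | no _   = assign-∷ʳ-∈ ā x̄ y∈x̄

  -- Freshness of `x` ensures that no earlier entry captures it; the search falls through to the
  -- last one.
  assign-∷ʳ-∉ : ∀ {n} (ā : Vec Preelement n) {a} (x̄ : Vec Var n) {x} → x ∉ Vec.toList x̄ →
                assign (ā ∷ʳ a) (x̄ ∷ʳ x) x ≡ a
  assign-∷ʳ-∉ [] [] {x} x∉x̄ with x ≟ᵛ x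
  ... | yes _  = refl
  ... | no x≢x = contradiction refl x≢x
  assign-∷ʳ-∉ (a ∷ ā) (y ∷ x̄) {x} x∉x̄ with x ≟ᵛ y
  ... | yes x≡y = contradiction (here x≡y) x∉x̄
  ... | no _    = assign-∷ʳ-∉ ā x̄ (x∉x̄ ∘ there)

  module _ {m n} {ā : Vec Preelement m} {x̄ : Vec Var m} {b̄ : Vec Preelement n} {ȳ : Vec Var n}
    where

    substᵉ-cong : ∀ t → (∀ {y} → y ∈ varsᵉ t → assign ā x̄ y ≡ assign b̄ ȳ y) →
                  t [ ā / x̄ ]ᵉ ≡ t [ b̄ / ȳ ]ᵉ
    substᵉˢ-cong : ∀ ts → (∀ {y} → y ∈ varsᵉˢ ts → assign ā x̄ y ≡ assign b̄ ȳ y) →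
                   ts [ ā / x̄ ]ᵉˢ ≡ ts [ b̄ / ȳ ]ᵉˢ
    substᵉ-cong (var y)    eq = eq (here refl)
    substᵉ-cong (fun f ts) eq = cong (fun f) (substᵉˢ-cong ts eq)
    substᵉˢ-cong []        eq = refl
    substᵉˢ-cong (t ∷ ts)  eq = cong₂ _∷_ (substᵉ-cong t (eq ∘ ∈-++⁺ˡ))
                                          (substᵉˢ-cong ts (eq ∘ ∈-++⁺ʳ (varsᵉ t)))

  substᵗ-∷ʳ : ∀ {n} (ā : Vec Preelement n) {a} (x̄ : Vec Var n) {x} A → varsᵗ A ⊆ Vec.toList x̄ →
              A [ ā ∷ʳ a / x̄ ∷ʳ x ]ᵗ ≡ A [ ā / x̄ ]ᵗ
  substᵗ-∷ʳ ā x̄ (typ S ts) A⊆x̄ =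
    cong (typ S) (substᵉˢ-cong ts λ y∈ts → assign-∷ʳ-∈ ā x̄ (A⊆x̄ y∈ts))

  substᵉˢ-map : ∀ {n} {b̄ : Vec Preelement n} {ȳ} ts → ts [ b̄ / ȳ ]ᵉˢ ≡ List.map (_[ b̄ / ȳ ]ᵉ) ts
  substᵉˢ-map []       = refl
  substᵉˢ-map (t ∷ ts) = cong (_ ∷_) (substᵉˢ-map ts)

  select-subst : ∀ {m n} {b̄ : Vec Preelement n} {ȳ} (ā : Vec Preelement m) ī →
                 select (Vec.map (_[ b̄ / ȳ ]ᵉ) ā) ī ≡ select ā ī [ b̄ / ȳ ]ᵉˢ
  select-subst ā ī = trans (List.map-cong (λ i → lookup-map i _ ā) ī)
    (trans (List.map-∘ ī) (sym (substᵉˢ-map (select ā ī))))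

  -- This is where composing substitutions needs scoping: for `y` outside `x̄` the left side would
  -- be `assign b̄ ȳ y`, the right side `var y`.
  assign-subst : ∀ {m n} (ā : Vec Preelement m) (x̄ : Vec Var m) {b̄ : Vec Preelement n} {ȳ} {y} →
                 y ∈ Vec.toList x̄ →
                 assign ā x̄ y [ b̄ / ȳ ]ᵉ ≡ assign (Vec.map (_[ b̄ / ȳ ]ᵉ) ā) x̄ y
  assign-subst (a ∷ ā) (x ∷ x̄) {y = y} y∈x̄ with y ≟ᵛ x
  ... | yes _ = refl
  assign-subst (a ∷ ā) (x ∷ x̄) (here y≡x)  | no y≢x = contradiction y≡x y≢x
  assign-subst (a ∷ ā) (x ∷ x̄) (there y∈x̄) | no _   = assign-subst ā x̄ y∈x̄

  module _ {m n} (ā : Vec Preelement m) (x̄ : Vec Var m) {b̄ : Vec Preelement n} {ȳ : Vec Var n}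
    where

    substᵉ-∘ : ∀ t → varsᵉ t ⊆ Vec.toList x̄ →
               t [ ā / x̄ ]ᵉ [ b̄ / ȳ ]ᵉ ≡ t [ Vec.map (_[ b̄ / ȳ ]ᵉ) ā / x̄ ]ᵉ
    substᵉˢ-∘ : ∀ ts → varsᵉˢ ts ⊆ Vec.toList x̄ →
                ts [ ā / x̄ ]ᵉˢ [ b̄ / ȳ ]ᵉˢ ≡ ts [ Vec.map (_[ b̄ / ȳ ]ᵉ) ā / x̄ ]ᵉˢ
    substᵉ-∘ (var y)    t⊆x̄ = assign-subst ā x̄ (t⊆x̄ (here refl))
    substᵉ-∘ (fun f ts) t⊆x̄ = cong (fun f) (substᵉˢ-∘ ts t⊆x̄)
    substᵉˢ-∘ []        t⊆x̄ = refl
    substᵉˢ-∘ (t ∷ ts)  t⊆x̄ = cong₂ _∷_ (substᵉ-∘ t (t⊆x̄ ∘ ∈-++⁺ˡ))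
                                        (substᵉˢ-∘ ts (t⊆x̄ ∘ ∈-++⁺ʳ (varsᵉ t)))

    substᵗ-∘ : ∀ A → varsᵗ A ⊆ Vec.toList x̄ →
               A [ ā / x̄ ]ᵗ [ b̄ / ȳ ]ᵗ ≡ A [ Vec.map (_[ b̄ / ȳ ]ᵉ) ā / x̄ ]ᵗ
    substᵗ-∘ (typ S ts) A⊆x̄ = cong (typ S) (substᵉˢ-∘ ts A⊆x̄)

  -- Variables of derivable judgements

  types-scoped : ∀ {Γ} → IsPrecontext Γ → ∀ i → varsᵗ (Vec.lookup (types Γ) i) ⊆ varsᶜ Γ
  types-scoped (ext {Γ} {x} {A} pΓ _ A⊆Γ) i with view i
  ... | ‵fromℕ     rewrite lookup-∷ʳ-fromℕ (types Γ) A     = toList-⊆-∷ʳ (OV Γ) ∘ A⊆Γ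
  ... | ‵inject₁ j rewrite lookup-∷ʳ-inject₁ (types Γ) A j =
    toList-⊆-∷ʳ (OV Γ) ∘ types-scoped pΓ j

  -- Each component substitutes only the entries of `s̄` that precede it. In a precontext its type
  -- has no later variables, so the full substitution by `s̄` has the same effect.
  components-lookup : ∀ {Θ Γ s̄} {P : Judgement → Set} → IsPrecontext Γ →
    All P (components Θ Γ s̄) → ∀ i →
    P (assign s̄ (OV Γ) (Vec.lookup (OV Γ) i) ∶ Vec.lookup (types Γ) i [ s̄ / OV Γ ]ᵗ ⟨ Θ ⟩)
  components-lookup {Θ} {s̄ = s̄} {P} (ext {Γ} {x} {A} pΓ x∈φ A⊆Γ) ps i with view i
  ... | ‵fromℕ
    rewrite lookup-∷ʳ-fromℕ (OV Γ) x | lookup-∷ʳ-fromℕ (types Γ) A =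
      subst P
        (cong₂ (_∶_⟨ Θ ⟩)
          -- An arbitrary `s̄` is not literally of the form `_ ∷ʳ _`, so `init-last` puts it in that
          -- form before the lemmas on appended entries apply.
          (trans (sym (assign-∷ʳ-∉ (Vec.init s̄) (OV Γ) (φ-avoids x∈φ)))
                 (cong (λ s̄ → assign s̄ (OV Γ ∷ʳ x) x) (sym (init-last s̄))))
          (trans (sym (substᵗ-∷ʳ (Vec.init s̄) (OV Γ) A A⊆Γ))
                 (cong (λ s̄ → A [ s̄ / OV Γ ∷ʳ x ]ᵗ) (sym (init-last s̄)))))
        (proj₂ (∷ʳ⁻ ps))
  ... | ‵inject₁ j
    rewrite lookup-∷ʳ-inject₁ (OV Γ) x j | lookup-∷ʳ-inject₁ (types Γ) A j =
      subst P
        (cong₂ (_∶_⟨ Θ ⟩)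
          (trans (sym (assign-∷ʳ-∈ (Vec.init s̄) (OV Γ) (∈-toList⁺ (∈-lookup j (OV Γ)))))
                 (cong (λ s̄ → assign s̄ (OV Γ ∷ʳ x) y) (sym (init-last s̄))))
          (trans (sym (substᵗ-∷ʳ (Vec.init s̄) (OV Γ) B (types-scoped pΓ j)))
                 (cong (λ s̄ → B [ s̄ / OV Γ ∷ʳ x ]ᵗ) (sym (init-last s̄)))))
        (components-lookup pΓ (proj₁ (∷ʳ⁻ ps)) j)
    where
    y = Vec.lookup (OV Γ) j
    B = Vec.lookup (types Γ) j

  -- An invariant of all rules. The clause for elements bounds the variables of the term, because R4
  -- and R5 build their subjects from the terms of a context map; the clause for types is what R2
  -- needs to extend a precontext.
  Scoped : Judgement → Set
  Scoped (Γ context)   = IsPrecontext Γ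
  Scoped (A type⟨ Γ ⟩) = varsᵗ A ⊆ varsᶜ Γ
  Scoped (a ∶ A ⟨ Γ ⟩) = varsᵉ a ⊆ varsᶜ Γ

  components-scoped : ∀ {Δ} Γ {ā} → All Scoped (components Δ Γ ā) →
                      ∀ i → varsᵉ (Vec.lookup ā i) ⊆ varsᶜ Δ
  components-scoped {Δ} (Γ ▸ x ∶ A) {ā} ps i = subst (λ ā → varsᵉ (Vec.lookup ā i) ⊆ varsᶜ Δ)
    (sym (init-last ā)) (go (view i))
    where
    go : ∀ {i} → View i → varsᵉ (Vec.lookup (Vec.init ā ∷ʳ Vec.last ā) i) ⊆ varsᶜ Δ
    go ‵fromℕ rewrite lookup-∷ʳ-fromℕ (Vec.init ā) (Vec.last ā) = proj₂ (∷ʳ⁻ ps)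
    go (‵inject₁ j) rewrite lookup-∷ʳ-inject₁ (Vec.init ā) (Vec.last ā) j =
      components-scoped Γ (proj₁ (∷ʳ⁻ ps)) j

  select-scoped : ∀ {n X} (ā : Vec Preelement n) → (∀ i → varsᵉ (Vec.lookup ā i) ⊆ X) →
                  ∀ ī → varsᵉˢ (select ā ī) ⊆ X
  select-scoped ā ā⊆X (i ∷ ī) =
    [ ā⊆X i , select-scoped ā ā⊆X ī ]′ ∘ ∈-++⁻ (varsᵉ (Vec.lookup ā i))

  module _ {Σ : Presignature} where
    open Presignature Σ

    Rule-scoped : ∀ {ps 𝒰} → Rule Σ ps 𝒰 → All Scoped ps → Scoped 𝒰
    Rule-scoped R1 [] = ⟨⟩
    Rule-scoped (R2 x∈φ) (pΓ ∷ A⊆Γ ∷ []) = ext pΓ x∈φ A⊆Γ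
    Rule-scoped (R3 {Γ} i) _ (here refl) = ∈-toList⁺ (∈-lookup i (OV Γ))
    Rule-scoped (R4 {Γ} {ī = ī} _ ā) (_ ∷ _ ∷ ps) =
      select-scoped ā (components-scoped Γ ps) ī
    Rule-scoped (R5 {Γ} {ī = ī} _ ā) (_ ∷ _ ∷ ps) =
      select-scoped ā (components-scoped Γ (proj₁ (∷ʳ⁻ ps))) ī

    𝒥-scoped : ∀ {𝒰} → 𝒥 Σ 𝒰 → Scoped 𝒰
    All-𝒥-scoped : ∀ {ps} → All (𝒥 Σ) ps → All Scoped ps
    𝒥-scoped (infer r ds)   = Rule-scoped r (All-𝒥-scoped ds)
    All-𝒥-scoped []         = []
    All-𝒥-scoped (d ∷ ds)   = 𝒥-scoped d ∷ All-𝒥-scoped ds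

    -- Heights

    ⊢-mono : ∀ {k l 𝒰} → k ≤ l → Σ ⊢[ k ] 𝒰 → Σ ⊢[ l ] 𝒰
    ⊢-mono k≤l (d , h≤k) = d , ≤-trans h≤k k≤l

    -- Converse to `⊢-infer`: it turns a bound on the largest premiss height into one common bound
    -- for all premisses, the form in which the induction consumes them.
    max-heights≤⇒All-⊢ : ∀ {k ps} (ds : All (𝒥 Σ) ps) → max 0 (heights ds) ≤ k →
                         All (Σ ⊢[ k ]_) ps
    max-heights≤⇒All-⊢ {k} ds h≤k =
      go ds (All.map (λ h≤max → ≤-trans h≤max h≤k) (xs≤max 0 (heights ds)))
      where
      go : ∀ {ps} (ds : All (𝒥 Σ) ps) → All (_≤ k) (heights ds) → All (Σ ⊢[ k ]_) ps
      go []       []         = []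
      go (d ∷ ds) (h≤k ∷ hs) = (d , h≤k) ∷ go ds hs

    ⊢-infer : ∀ {k ps 𝒰} → Rule Σ ps 𝒰 → All (Σ ⊢[ k ]_) ps → Σ ⊢[ suc k ] 𝒰
    ⊢-infer {k} r ps = infer r (All.map proj₁ ps) , inferenceHeight≤ (bounds ps)
      where
      bounds : ∀ {ps} (ds : All (Σ ⊢[ k ]_) ps) → All (_≤ k) (heights (All.map proj₁ ds))
      bounds []             = []
      bounds ((_ , h) ∷ ds) = h ∷ bounds ds

      inferenceHeight≤ : ∀ {hs} → All (_≤ k) hs → inferenceHeight hs ≤ suc k
      -- No premisses: this is R1, of height 0.
      inferenceHeight≤ []       = z≤n
      inferenceHeight≤ (h ∷ hs) = s≤s (max≤v⁺ z≤n (h ∷ hs))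

    contextMap-⊢ : ∀ {m̄ ps} → Pointwise (Σ ⊢[_]_) m̄ ps → All (Σ ⊢[ max 0 m̄ ]_) ps
    contextMap-⊢ {m̄} = go (xs≤max 0 m̄)
      where
      go : ∀ {k m̄ ps} → All (_≤ k) m̄ → Pointwise (Σ ⊢[_]_) m̄ ps → All (Σ ⊢[ k ]_) ps
      go []         []       = []
      go (m≤k ∷ hs) (d ∷ ds) = ⊢-mono m≤k d ∷ go hs ds

    -- Substitution into derivations.

    components-subst : ∀ {Θ Δ Γ k l} {s̄ : Vec Preelement ∣ Δ ∣} →
      (∀ {b B} → Σ ⊢[ k ] (b ∶ B ⟨ Δ ⟩) → Σ ⊢[ l ] (b [ s̄ / OV Δ ]ᵉ ∶ B [ s̄ / OV Δ ]ᵗ ⟨ Θ ⟩)) →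
      IsPrecontext Γ → ∀ ā → All (Σ ⊢[ k ]_) (components Δ Γ ā) →
      All (Σ ⊢[ l ]_) (components Θ Γ (Vec.map (_[ s̄ / OV Δ ]ᵉ) ā))
    components-subst sub ⟨⟩ ā [] = []
    components-subst {Δ = Δ} {s̄ = s̄} sub (ext {Γ} {x} {A} pΓ _ A⊆Γ) ā ds
      rewrite init-map (_[ s̄ / OV Δ ]ᵉ) ā
            | last-map (_[ s̄ / OV Δ ]ᵉ) ā
            -- Splits the single substitution in the goal into two successive ones, which is the
            -- form that `sub` delivers.
            | sym (substᵗ-∘ (Vec.init ā) (OV Γ) {b̄ = s̄} {ȳ = OV Δ} A A⊆Γ) =
      ∷ʳ⁺ (components-subst sub pΓ (Vec.init ā) (proj₁ (∷ʳ⁻ ds))) (sub (proj₂ (∷ʳ⁻ ds)))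

    module _ {Θ Γ : Ctx} {s̄ : Vec Preelement ∣ Γ ∣} {M : ℕ}
      (Θ-context : Σ ⊢[ M ] (Θ context)) (pΓ : IsPrecontext Γ)
      (s̄-components : All (Σ ⊢[ M ]_) (components Θ Γ s̄)) where

      -- `sub` stands for the induction hypothesis at `k`. That the target `Δ` is a precontext is
      -- read off from its own derivation.
      contextMap-subst : ∀ {Δ k ā} →
        (∀ {b B} → Σ ⊢[ k ] (b ∶ B ⟨ Γ ⟩) →
                   Σ ⊢[ k + M ] (b [ s̄ / OV Γ ]ᵉ ∶ B [ s̄ / OV Γ ]ᵗ ⟨ Θ ⟩)) →
        All (Σ ⊢[ k ]_) (contextMap Γ Δ ā) →
        All (Σ ⊢[ k + M ]_) (contextMap Θ Δ (Vec.map (_[ s̄ / OV Γ ]ᵉ) ā))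
      contextMap-subst {k = k} {ā} sub (_ ∷ dΔ ∷ ds) =
        ⊢-mono (m≤n+m M k) Θ-context ∷ ⊢-mono (m≤m+n k M) dΔ ∷
        components-subst sub (𝒥-scoped (proj₁ dΔ)) ā ds

      -- The recursion decreases `k` rather than the derivation, since the premisses come back
      -- repackaged with the common bound. The two statements are mutual: R4 has element premisses
      -- and R5 has a type premiss.
      substᵗ-⊢ : ∀ k {B} → Σ ⊢[ k ] (B type⟨ Γ ⟩) → Σ ⊢[ k + M ] (B [ s̄ / OV Γ ]ᵗ type⟨ Θ ⟩)
      substᵉ-⊢ : ∀ k {b B} → Σ ⊢[ k ] (b ∶ B ⟨ Γ ⟩) →
                 Σ ⊢[ k + M ] (b [ s̄ / OV Γ ]ᵉ ∶ B [ s̄ / OV Γ ]ᵗ ⟨ Θ ⟩)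

      -- Matching `ds` as nonempty makes its height compute to a successor, which excludes the bound
      -- 0.
      substᵗ-⊢ (suc k) (infer (R4 {S = S} {ī} decl ā) ds@(_ ∷ _) , s≤s h≤k) =
        subst (λ ts → Σ ⊢[ suc k + M ] (typ S ts type⟨ Θ ⟩)) (select-subst ā ī)
          (⊢-infer (R4 decl _) (contextMap-subst (substᵉ-⊢ k) (max-heights≤⇒All-⊢ ds h≤k)))

      substᵉ-⊢ k (infer (R3 i) _ , _) =
        ⊢-mono (m≤n+m M k) (components-lookup pΓ s̄-components i)
      substᵉ-⊢ (suc k) (infer (R5 {Δ} {f} {ī} {U} decl ā) ds@(_ ∷ _) , s≤s h≤k)
        -- Supplies the inclusion of the variables of `U` in those of `Δ`, needed to compose
        -- substitutions in `U`.
        with predeclaration decl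
      ... | funDecl _ _ U⊆Δ =
        -- R5 for the substituted map speaks of `U` under one composite substitution. `U-subst` is
        -- used forwards to fit the type premiss and backwards to restore the required conclusion.
        subst (λ (ts , A) → Σ ⊢[ suc k + M ] (fun f ts ∶ A ⟨ Θ ⟩))
          (cong₂ _,_ (select-subst ā ī) (sym U-subst))
          (⊢-infer (R5 decl _)
            (∷ʳ⁺ (contextMap-subst (substᵉ-⊢ k) (proj₁ premisses))
                 (subst (λ A → Σ ⊢[ k + M ] (A type⟨ Θ ⟩)) U-subst
                        (substᵗ-⊢ k (proj₂ premisses)))))
        where
        premisses = ∷ʳ⁻ {xs = contextMap Γ Δ ā} (max-heights≤⇒All-⊢ ds h≤k)
        U-subst   = substᵗ-∘ ā (OV Δ) {b̄ = s̄} {ȳ = OV Γ} U U⊆Δ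

mainTheorem2 : (L : Language) → let open Syntax L in
    (Σ : Presignature) → IsSignature Σ →
    (Θ Γ : Ctx) (s̄ : Vec Preelement ∣ Γ ∣) (m̄ : List ℕ) →
    Σ ⊢⟨ m̄ ⟩ Θ ⟶ Γ ∋ s̄ →
    ((k : ℕ) (B : Pretype) →
    Σ ⊢[ k ] (B type⟨ Γ ⟩) →
    Σ ⊢[ k + max 0 m̄ ] (B [ s̄ / OV Γ ]ᵗ type⟨ Θ ⟩))
    ×
    ((k : ℕ) (b : Preelement) (B : Pretype) →
    Σ ⊢[ k ] (b ∶ B ⟨ Γ ⟩) →
    Σ ⊢[ k + max 0 m̄ ] (b [ s̄ / OV Γ ]ᵉ ∶ B [ s̄ / OV Γ ]ᵗ ⟨ Θ ⟩))
mainTheorem2 L Σ _ Θ Γ s̄ m̄ ds with Metatheory.contextMap-⊢ L ds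
-- All judgements of the map now share the bound `max 0 m̄`, which serves as `M`.
... | Θ-context ∷ (dΓ , _) ∷ s̄-components =
  (λ k B → substᵗ-⊢ Θ-context (𝒥-scoped dΓ) s̄-components k) ,
  (λ k b B → substᵉ-⊢ Θ-context (𝒥-scoped dΓ) s̄-components k)
  where open Metatheory L
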